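{- Let $q\in\{3,4\}$ and $d\ge 1$ be integers, and let $T$ be the complete $q$-ary tree of depth $d$. Then there is some $\varepsilon\in[-1-\log_q(2),\,3]$ such that $\Phi_V(T)=d-\log_q(d)+\varepsilon$.
   Context: The complete $q$-ary tree of depth $d$ is the rooted tree in which every vertex at distance less than $d$ from the root has exactly $q$ children, and the vertices at distance $d$ from the root are leaves. For a graph $G$ and $S\subseteq V(G)$, the vertex-border is $\delta(S)=\{v\in V(G)\setminus S : N(v)\cap S\neq\emptyset\}$. The vertex-isoperimetric parameter is $\Phi_V(G,s)=\min_{S\subseteq V(G),\,|S|=s}|\delta(S)|$, and the vertex-isoperimetric peak is $\Phi_V(G)=\max_{0\le s\le |V(G)|}\Phi_V(G,s)$. -}

module Defs where

open import Data.Nat using (ℕ; zero; suc; _+_; _*_; _^_; _≤_; _≤?_; _⊓_; _⊔_; _≟_)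
open import Data.Fin using (Fin; toℕ)
open import Data.Fin.Subset using (Subset; _∈_; _∉_; ∣_∣)
open import Data.Fin.Subset.Properties using (_∈?_)
open import Data.Fin.Properties using (any?)
open import Data.Vec using (Vec; []; _∷_; tabulate)
open import Data.Bool using (Bool; true; false)
open import Data.List using (List; []; _∷_; map; _++_; filter; foldr; upTo)
open import Data.Product using (_×_; ∃; _,_)
open import Data.Sum using (_⊎_)
open import Relation.Nullary using (Dec; ¬_; yes; no; does)
open import Relation.Nullary.Decidable using (_×-dec_; _⊎-dec_; ¬?)
open import Relation.Binary.PropositionalEquality using (_≡_)

-- Complete q-ary tree of depth d, in the standard "heap" numbering:
-- vertices are 0 , 1 , ... , N-1 with N = q^0 + q^1 + ... + q^d,
-- the root is 0, and the children of vertex p are q*p+1 , ... , q*p+q.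
-- (Depth l occupies the block of indices [ q^0+...+q^(l-1) , q^0+...+q^l ).)

treeSize : ℕ → ℕ → ℕ
treeSize q zero    = 1
treeSize q (suc d) = treeSize q d + q ^ suc d

ChildOf : ℕ → ℕ → ℕ → Set
ChildOf q p c = suc (q * p) ≤ c × c ≤ q * p + q

childOf? : ∀ q p c → Dec (ChildOf q p c)
childOf? q p c = (suc (q * p) ≤? c) ×-dec (c ≤? q * p + q)

Adj : ℕ → ℕ → ℕ → Set
Adj q u v = ChildOf q u v ⊎ ChildOf q v u

adj? : ∀ q u v → Dec (Adj q u v)
adj? q u v = childOf? q u v ⊎-dec childOf? q v u

Vtx : ℕ → ℕ → Set
Vtx q d = Fin (treeSize q d)

border : ∀ q d → Subset (treeSize q d) → Subset (treeSize q d)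
border q d S = tabulate λ v →
  does (¬? (v ∈? S) ×-dec any? (λ u → (u ∈? S) ×-dec adj? q (toℕ u) (toℕ v)))

allSubsets : ∀ n → List (Subset n)
allSubsets zero    = [] ∷ []
allSubsets (suc n) = map (true ∷_) (allSubsets n) ++ map (false ∷_) (allSubsets n)

-- Φ_V(T, s) = min { |δ(S)| : |S| = s }.  (The fold starts from N, which is
-- an upper bound for every |δ(S)|, so for 0 ≤ s ≤ N this is exactly the minimum.)
ΦV-s : ℕ → ℕ → ℕ → ℕ
ΦV-s q d s = foldr (λ S m → ∣ border q d S ∣ ⊓ m) (treeSize q d)
               (filter (λ S → ∣ S ∣ ≟ s) (allSubsets (treeSize q d)))

ΦV : ℕ → ℕ → ℕ
ΦV q d = foldr (λ s m → ΦV-s q d s ⊔ m) 0 (upTo (suc (treeSize q d)))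

{-# OPTIONS --safe #-}
module Submission where

open import Defs
open import Data.Bool using (Bool; true; false; _∨_)
open import Data.Bool.Properties using (∨-zeroʳ)
open import Data.Empty using (⊥-elim)
open import Data.Fin using (Fin; toℕ; fromℕ<) renaming (zero to zeroᶠ; suc to sucᶠ)
open import Data.Fin.Properties using (any?; toℕ-fromℕ<; toℕ<n)
open import Data.Fin.Subset using (Subset; ∣_∣) renaming (_∈_ to _∈ₛ_)
open import Data.Fin.Subset.Properties using (_∈?_)
open import Data.List using ([]; _∷_; foldr; map; upTo)
open import Data.List.Membership.Propositional using (_∈_)
open import Data.List.Membership.Propositional.Properties
  using (∈-map⁺; ∈-++⁺ˡ; ∈-++⁺ʳ; ∈-filter⁺; ∈-filter⁻; ∈-upTo⁺; ∈-upTo⁻)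
open import Data.List.Relation.Unary.Any using (here; there)
open import Data.Nat
open import Data.Nat.DivMod using (m≡m%n+[m/n]*n; m%n<n)
open import Data.Nat.Properties hiding (_≟_)
open import Data.Nat.Tactic.RingSolver using (solve; solve-∀)
open import Data.Product using (_×_; _,_; proj₁; proj₂; ∃; ∃₂)
open import Data.Sum using (_⊎_; inj₁; inj₂)
open import Data.Vec using (Vec; lookup; tabulate) renaming ([] to []ᵥ; _∷_ to _∷ᵥ_)
open import Data.Vec.Properties using ([]=⇒lookup; lookup⇒[]=; lookup∘tabulate)
open import Function using (_∘_)
open import Relation.Nullary using (Dec; yes; no; ¬_; does)
open import Relation.Nullary.Decidable using (_×-dec_; ¬?; dec-true)
open import Relation.Binary.PropositionalEquality

-- Only the numbers a_l and b_l of vertices of S and of δ(S) on level l matter: they satisfy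
-- a_{l+1} ≤ q (a_l + b_l) and q a_l ≤ a_{l+1} + b_{l+1}, and conversely initial segments of the levels,
-- in the order of the heap numbering, realise every such sequence.  Write T_n = 1 + q + … + q^{n-1}.
--
-- Lower bound: take |S| = T_0 + … + T_d.  If |δ(S)| is small, then the last a_l is known up to an error
-- below T_n, where T_n is of order d.  Going up one level divides the error by q, and since the
-- repunits T_l are 1 modulo q, every level passed with b_l = 0 shrinks the admissible error from T_{n+1} to T_n;
-- hence at least d + 2 - n border vertices are needed.
--
-- Upper bound: writing s greedily as X_0 T_d + X_1 T_{d-1} + … costs one border vertex per nonzero
-- digit.  To save the last L ≈ log_q d digits, their contribution (less than T_{L+1}) is absorbed
-- higher up.  For q ≤ 4, in any three consecutive levels one of the a_l can be changed by one
-- without exceeding the three border vertices allotted to them: a digit X ≤ 1 allows a decrease and a digit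
-- X ≥ q - 2 an increase.  Depending on which of the two is available often enough, the
-- truncated expansion is rounded up or down.

-- A certificate y - x = (r - l) + slack, with the subtractions moved to the other sides.
farkas : ∀ {l r x y} → l ≤ r → ∀ slack → x + r + slack ≡ y + l → x ≤ y
farkas {l} {r} {x} {y} l≤r slack eq = +-cancelʳ-≤ r x y (begin
  x + r          ≤⟨ m≤m+n (x + r) slack ⟩
  x + r + slack  ≡⟨ eq ⟩
  y + l          ≤⟨ +-monoʳ-≤ y l≤r ⟩
  y + r          ∎)
  where open ≤-Reasoning

-- The type of *-monoʳ-≤ contains operator sections, which the ring solver does not reduce.
scale : ∀ q {m n} → m ≤ n → q * m ≤ q * n
scale q = *-monoʳ-≤ q

-- Repunits

T : ℕ → ℕ → ℕ
T q zero    = 0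
T q (suc n) = suc (q * T q n)

T-suc : ∀ q n → T q (suc n) ≡ T q n + q ^ n
T-suc q zero    = cong suc (*-zeroʳ q)
T-suc q (suc n) = cong suc (begin
  q * T q (suc n)            ≡⟨ cong (q *_) (T-suc q n) ⟩
  q * (T q n + q ^ n)        ≡⟨ *-distribˡ-+ q (T q n) (q ^ n) ⟩
  q * T q n + q * q ^ n      ∎)
  where open ≡-Reasoning

treeSize≡T : ∀ q d → treeSize q d ≡ T q (suc d)
treeSize≡T q zero    = sym (cong suc (*-zeroʳ q))
treeSize≡T q (suc d) = trans (cong (_+ q ^ suc d) (treeSize≡T q d)) (sym (T-suc q (suc d)))

T-mono : ∀ q {m n} → m ≤ n → T q m ≤ T q n
T-mono q z≤n       = z≤n
T-mono q (s≤s m≤n) = s≤s (*-monoʳ-≤ q (T-mono q m≤n))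

T-growth : ∀ q n b → 1 ≤ q → T q n + b ≤ T q (n + b)
T-growth q zero    zero    _   = z≤n
T-growth q zero    (suc b) 1≤q = s≤s (≤-trans (T-growth q zero b 1≤q) (m≤n*m (T q b) q {{>-nonZero 1≤q}}))
T-growth q (suc n) b       1≤q = s≤s (begin
  q * T q n + b          ≤⟨ +-monoʳ-≤ (q * T q n) (m≤n*m b q {{>-nonZero 1≤q}}) ⟩
  q * T q n + q * b      ≡⟨ *-distribˡ-+ q (T q n) b ⟨
  q * (T q n + b)        ≤⟨ *-monoʳ-≤ q (T-growth q n b 1≤q) ⟩
  q * T q (n + b)        ∎)
  where open ≤-Reasoning

n≤T : ∀ q n → 1 ≤ q → n ≤ T q n
n≤T q n = T-growth q 0 n

-- (q - 1) T n + 1 = q ^ n, without subtraction.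
T-power : ∀ q n → q * T q n + 1 ≡ T q n + q ^ n
T-power q n = trans (+-comm (q * T q n) 1) (T-suc q n)

-- Lower bound for sequences of level counts

Σ< : (ℕ → ℕ) → ℕ → ℕ
Σ< f zero    = 0
Σ< f (suc n) = Σ< f n + f n

module _ (q : ℕ) (3≤q : 3 ≤ q) (a b : ℕ → ℕ)
         (a₀≤1 : a 0 ≤ 1)
         (parents : ∀ l → a (suc l) ≤ q * (a l + b l))
         (children : ∀ l → q * a l ≤ a (suc l) + b (suc l)) where

  private
    -- Both `c l` and `c (suc l)` divided by q lie between a_l and a_l + b_l, so `c` is multiplied
    -- by q from level to level with an error of at most q b_l. Using a_l itself would bring the
    -- border of the next level into the same estimate.
    c : ℕ → ℕ
    c zero    = a 0
    c (suc l) = a (suc l) ⊔ q * a l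

    a≤c : ∀ l → a l ≤ c l
    a≤c zero    = ≤-refl
    a≤c (suc l) = m≤m⊔n (a (suc l)) _

    c≤a+b : ∀ l → c l ≤ a l + b l
    c≤a+b zero    = m≤m+n (a 0) _
    c≤a+b (suc l) = ⊔-lub (m≤m+n (a (suc l)) _) (children l)

    qa≤c : ∀ l → q * a l ≤ c (suc l)
    qa≤c l = m≤n⊔m (a (suc l)) _

    c≤qa+qb : ∀ l → c (suc l) ≤ q * (a l + b l)
    c≤qa+qb l = ⊔-lub (parents l) (scale q (m≤m+n (a l) (b l)))

    0<q : 1 ≤ q
    0<q = ≤-trans (s≤s z≤n) 3≤q

    -- The window T_l - T_n < c_l ≤ T_l + T_n is carried up the levels. After division by q, the
    -- leading 1s of the repunits cancel in the lower estimate and add up to 2 < q in the upper one,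
    -- so rounding removes them: T_{n+1} becomes T_n + b_l, which is at most T_{n + b_l}. For n = 0
    -- the window is empty.
    sharp : ∀ l n → T q l < c l + T q n → c l ≤ T q l + T q n → l < Σ< b l + n
    sharp zero    zero    lo hi = ⊥-elim (n≮n 0 (≤-trans lo (≤-trans (≤-reflexive (+-identityʳ _)) hi)))
    sharp zero    (suc n) lo hi = s≤s z≤n
    sharp (suc l) zero    lo hi = ⊥-elim (n≮n _ (≤-trans lo (≤-trans (≤-reflexive (+-identityʳ _)) (≤-trans hi (≤-reflexive (+-identityʳ _))))))
    sharp (suc l) (suc n) lo hi = begin-strict
      suc l                         ≤⟨ sharp l (n + b l) lo′ hi′ ⟩
      Σ< b l + (n + b l)            <⟨ ≤-refl ⟩
      suc (Σ< b l + (n + b l))      ≡⟨ rearrange (Σ< b l) n (b l) ⟩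
      Σ< b (suc l) + suc n          ∎
      where
      open ≤-Reasoning
      rearrange : ∀ F n b → suc (F + (n + b)) ≡ F + b + suc n
      rearrange F n b = solve (F ∷ n ∷ b ∷ [])
      grow : T q n + b l ≤ T q (n + b l)
      grow = T-growth q n (b l) 0<q
      low : ∀ q t τ c c′ a b → c′ ≤ q * (a + b) → a ≤ c → suc (suc (q * t)) ≤ c′ + suc (q * τ) → q * t < q * (c + (τ + b))
      low q t τ c c′ a b h a≤c k = farkas (+-mono-≤ (+-mono-≤ h (scale q a≤c)) k) 0 (solve (q ∷ t ∷ τ ∷ c ∷ c′ ∷ a ∷ b ∷ []))
      high : ∀ q t τ c c′ a b → 3 ≤ q → q * a ≤ c′ → c ≤ a + b → c′ ≤ suc (q * t) + suc (q * τ) → q * c < q * suc (t + (τ + b))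
      high q t τ c c′ a b 3≤q h c≤a+b k =
        farkas (+-mono-≤ (+-mono-≤ h (scale q c≤a+b)) (+-mono-≤ k 3≤q)) 0
          (solve (q ∷ t ∷ τ ∷ c ∷ c′ ∷ a ∷ b ∷ []))
      lo′ : T q l < c l + T q (n + b l)
      lo′ = ≤-trans (*-cancelˡ-< q _ _ (low q (T q l) (T q n) (c l) _ (a l) (b l) (c≤qa+qb l) (a≤c l) lo)) (+-monoʳ-≤ (c l) grow)
      hi′ : c l ≤ T q l + T q (n + b l)
      hi′ = ≤-trans (≤-pred (*-cancelˡ-< q _ _ (high q (T q l) (T q n) (c l) _ (a l) (b l) 3≤q (qa≤c l) (c≤a+b l) hi))) (+-monoʳ-≤ (T q l) grow)

    -- Telescoping: c_{l+1} - c_l equals (q - 1) a_l up to an error between -b_l and q b_l. Together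
    -- with `sum-lower`, this makes the total size of S determine the last `c` up to a multiple of
    -- the border.
    sum-upper : ∀ l → c l + Σ< a l ≤ q * Σ< a l + 1 + q * Σ< b l
    sum-upper zero    = begin
      a 0 + 0                ≡⟨ +-identityʳ (a 0) ⟩
      a 0                    ≤⟨ a₀≤1 ⟩
      1                      ≤⟨ m≤n+m 1 (q * 0) ⟩
      q * 0 + 1              ≤⟨ m≤m+n _ _ ⟩
      q * 0 + 1 + q * 0      ∎
      where open ≤-Reasoning
    sum-upper (suc l) = go q (c l) (c (suc l)) (a l) (b l) (Σ< a l) (Σ< b l) (sum-upper l) (a≤c l) (c≤qa+qb l)
      where
      go : ∀ q c c′ a b A F → c + A ≤ q * A + 1 + q * F → a ≤ c → c′ ≤ q * (a + b) →
           c′ + (A + a) ≤ q * (A + a) + 1 + q * (F + b)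
      go q c c′ a b A F ih h k = farkas (+-mono-≤ ih (+-mono-≤ h k)) 0 (solve (q ∷ c ∷ c′ ∷ a ∷ b ∷ A ∷ F ∷ []))

    sum-lower : ∀ l → q * Σ< a l ≤ c l + Σ< a l + Σ< b l
    sum-lower zero    = ≤-trans (≤-reflexive (*-zeroʳ q)) z≤n
    sum-lower (suc l) = go q (c l) (c (suc l)) (a l) (b l) (Σ< a l) (Σ< b l) (sum-lower l) (c≤a+b l) (qa≤c l)
      where
      go : ∀ q c c′ a b A F → q * A ≤ c + A + F → c ≤ a + b → q * a ≤ c′ →
           q * (A + a) ≤ c′ + (A + a) + (F + b)
      go q c c′ a b A F ih h k = farkas (+-mono-≤ ih (+-mono-≤ h k)) 0 (solve (q ∷ c ∷ c′ ∷ a ∷ b ∷ A ∷ F ∷ []))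

    -- The same telescoping for the exact recursion T_{n+1} = 1 + q T_n, where every level
    -- contributes an error of 1.
    ΣT : ∀ n → q * Σ< (T q) n + n ≡ Σ< (T q) n + T q n
    ΣT zero    = cong (_+ 0) (*-zeroʳ q)
    ΣT (suc n) = go (Σ< (T q) n) (T q n) (ΣT n)
      where
      go : ∀ Z t → q * Z + n ≡ Z + t → q * (Z + t) + suc n ≡ Z + t + suc (q * t)
      go Z t ih = begin
        q * (Z + t) + suc n            ≡⟨ regroup q Z t n ⟩
        (q * Z + n) + suc (q * t)      ≡⟨ cong (_+ suc (q * t)) ih ⟩
        Z + t + suc (q * t)            ∎
        where
        open ≡-Reasoning
        regroup : ∀ q Z t n → q * (Z + t) + suc n ≡ (q * Z + n) + suc (q * t)
        regroup q Z t n = solve (q ∷ Z ∷ t ∷ n ∷ [])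

  -- With F the border size, the telescoped sums give T_{d+1} - (d + 1) - F ≤ c_{d+1} ≤ T_{d+1} - d
  -- + q F. The two smallness hypotheses place this inside the window of `sharp`, which is entered
  -- on level d + 1, just below the leaves.
  border-lower-bound : ∀ d n → Σ< a (suc d) ≡ Σ< (T q) (suc d) →
    q * Σ< b (suc d) ≤ T q n + d → Σ< b (suc d) + suc d < T q n → suc d < Σ< b (suc d) + n
  border-lower-bound d n sum small₁ small₂ = sharp (suc d) n
      (lo q (c (suc d)) (Σ< a (suc d)) (T q (suc d)) (T q n) (Σ< b (suc d)) d ΣT′ (sum-lower (suc d)) small₂)
      (hi q (c (suc d)) (Σ< a (suc d)) (T q (suc d)) (T q n) (Σ< b (suc d)) d ΣT′ (sum-upper (suc d)) small₁)
    where
    ΣT′ : q * Σ< a (suc d) + suc d ≡ Σ< a (suc d) + T q (suc d)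
    ΣT′ = subst (λ z → q * z + suc d ≡ z + T q (suc d)) (sym sum) (ΣT (suc d))
    lo : ∀ q c A t τ F d → q * A + suc d ≡ A + t → q * A ≤ c + A + F → F + suc d < τ → t < c + τ
    lo q c A t τ F d e h k = farkas (+-mono-≤ (≤-reflexive (sym e)) (+-mono-≤ h k)) 0 (solve (q ∷ c ∷ A ∷ t ∷ τ ∷ F ∷ d ∷ []))
    hi : ∀ q c A t τ F d → q * A + suc d ≡ A + t → c + A ≤ q * A + 1 + q * F → q * F ≤ τ + d → c ≤ t + τ
    hi q c A t τ F d e h k = farkas (+-mono-≤ (≤-reflexive e) (+-mono-≤ h k)) 0 (solve (q ∷ c ∷ A ∷ t ∷ τ ∷ F ∷ d ∷ []))

-- Counting along initial segments of the natural numbers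

indicator : Bool → ℕ
indicator true  = 1
indicator false = 0

count : (ℕ → Bool) → ℕ → ℕ
count f zero    = 0
count f (suc n) = indicator (f 0) + count (f ∘ suc) n

indicator-mono : ∀ x y → (x ≡ true → y ≡ true) → indicator x ≤ indicator y
indicator-mono false y     _ = z≤n
indicator-mono true  true  _ = ≤-refl
indicator-mono true  false h with () ← h refl

count-mono : ∀ {f g} n → (∀ i → i < n → f i ≡ true → g i ≡ true) → count f n ≤ count g n
count-mono         zero    h = z≤n
count-mono {f} {g} (suc n) h =
  +-mono-≤ (indicator-mono (f 0) (g 0) (h 0 (s≤s z≤n))) (count-mono n (λ i i<n → h (suc i) (s≤s i<n)))

count-+ : ∀ f m n → count f (m + n) ≡ count f m + count (λ i → f (m + i)) n
count-+ f zero    n = refl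
count-+ f (suc m) n = trans (cong (indicator (f 0) +_) (count-+ (f ∘ suc) m n)) (sym (+-assoc (indicator (f 0)) _ _))

indicator-∨ : ∀ x y → indicator (x ∨ y) ≤ indicator x + indicator y
indicator-∨ true  y = m≤m+n 1 _
indicator-∨ false y = ≤-refl

count-∨ : ∀ f g n → count (λ i → f i ∨ g i) n ≤ count f n + count g n
count-∨ f g zero    = z≤n
count-∨ f g (suc n) = regroup (indicator (f 0)) (indicator (g 0)) _ _ (indicator-∨ (f 0) (g 0)) (count-∨ (f ∘ suc) (g ∘ suc) n)
  where
  regroup : ∀ a b c d {x y} → x ≤ a + b → y ≤ c + d → x + y ≤ a + c + (b + d)
  regroup a b c d p q = ≤-trans (+-mono-≤ p q) (≤-reflexive (interchange a b c d))
    where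
    interchange : ∀ a b c d → a + b + (c + d) ≡ a + c + (b + d)
    interchange = solve-∀

count-true : ∀ f n → (∀ i → i < n → f i ≡ true) → count f n ≡ n
count-true f zero    h = refl
count-true f (suc n) h rewrite h 0 (s≤s z≤n) = cong suc (count-true (f ∘ suc) n (λ i i<n → h (suc i) (s≤s i<n)))

count-≤ : ∀ f n → count f n ≤ n
count-≤ f n = ≤-trans (count-mono {g = λ _ → true} n (λ _ _ _ → refl)) (≤-reflexive (count-true _ n (λ _ _ → refl)))

count-false : ∀ f n → (∀ i → i < n → f i ≡ true → false ≡ true) → count f n ≡ 0
count-false f zero    h = refl
count-false f (suc n) h with f 0 in eq
... | true  with () ← h 0 (s≤s z≤n) eq
... | false = count-false (f ∘ suc) n (λ i i<n → h (suc i) (s≤s i<n))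

-- A block of q consecutive positions stands for the children of one vertex.
count-blocks-≤ : ∀ q n (f h : ℕ → Bool) → (∀ i j → j < q → f (i * q + j) ≡ true → h i ≡ true) →
                 count f (n * q) ≤ q * count h n
count-blocks-≤ q zero    f h H = z≤n
count-blocks-≤ q (suc n) f h H = begin
  count f (q + n * q)                                     ≡⟨ count-+ f q (n * q) ⟩
  count f q + count (λ i → f (q + i)) (n * q)             ≤⟨ +-mono-≤ first (count-blocks-≤ q n _ (h ∘ suc) rest) ⟩
  q * indicator (h 0) + q * count (h ∘ suc) n             ≡⟨ *-distribˡ-+ q (indicator (h 0)) _ ⟨
  q * (indicator (h 0) + count (h ∘ suc) n)               ∎
  where
  open ≤-Reasoning
  rest : ∀ i j → j < q → f (q + (i * q + j)) ≡ true → h (suc i) ≡ true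
  rest i j j<q e = H (suc i) j j<q (trans (cong f (+-assoc q (i * q) j)) e)
  first : count f q ≤ q * indicator (h 0)
  first with h 0 in eq
  ... | true  = ≤-trans (count-≤ f q) (≤-reflexive (sym (*-identityʳ q)))
  ... | false = ≤-trans (≤-reflexive (count-false f q (λ j j<q e → trans (sym eq) (H 0 j j<q e)))) z≤n

count-blocks-≥ : ∀ q n (f h : ℕ → Bool) → (∀ i j → i < n → j < q → h i ≡ true → f (i * q + j) ≡ true) →
                 q * count h n ≤ count f (n * q)
count-blocks-≥ q zero    f h H = ≤-reflexive (*-zeroʳ q)
count-blocks-≥ q (suc n) f h H = begin
  q * (indicator (h 0) + count (h ∘ suc) n)               ≡⟨ *-distribˡ-+ q (indicator (h 0)) _ ⟩
  q * indicator (h 0) + q * count (h ∘ suc) n             ≤⟨ +-mono-≤ first (count-blocks-≥ q n _ (h ∘ suc) rest) ⟩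
  count f q + count (λ i → f (q + i)) (n * q)             ≡⟨ count-+ f q (n * q) ⟨
  count f (q + n * q)                                     ∎
  where
  open ≤-Reasoning
  rest : ∀ i j → i < n → j < q → h (suc i) ≡ true → f (q + (i * q + j)) ≡ true
  rest i j i<n j<q e = trans (cong f (sym (+-assoc q (i * q) j))) (H (suc i) j (s≤s i<n) j<q e)
  first : q * indicator (h 0) ≤ count f q
  first with h 0 in eq
  ... | true  = ≤-reflexive (trans (*-identityʳ q) (sym (count-true f q (λ j j<q → H 0 j (s≤s z≤n) j<q eq))))
  ... | false = ≤-trans (≤-reflexive (*-zeroʳ q)) z≤n

extend : ∀ {n} → Bool → Vec Bool n → ℕ → Bool
extend x₀ []ᵥ       i       = x₀
extend x₀ (x ∷ᵥ xs) zero    = x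
extend x₀ (x ∷ᵥ xs) (suc i) = extend x₀ xs i

extend-toℕ : ∀ {n} x₀ (xs : Vec Bool n) i → extend x₀ xs (toℕ i) ≡ lookup xs i
extend-toℕ x₀ (x ∷ᵥ xs) zeroᶠ    = refl
extend-toℕ x₀ (x ∷ᵥ xs) (sucᶠ i) = extend-toℕ x₀ xs i

extend-≥ : ∀ {n} x₀ (xs : Vec Bool n) i → n ≤ i → extend x₀ xs i ≡ x₀
extend-≥ x₀ []ᵥ       i       _         = refl
extend-≥ x₀ (x ∷ᵥ xs) (suc i) (s≤s n≤i) = extend-≥ x₀ xs i n≤i

count-extend : ∀ {n} x₀ (xs : Subset n) → count (extend x₀ xs) n ≡ ∣ xs ∣
count-extend x₀ []ᵥ           = refl
count-extend x₀ (true  ∷ᵥ xs) = cong suc (count-extend x₀ xs)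
count-extend x₀ (false ∷ᵥ xs) = count-extend x₀ xs

∣tabulate∣ : ∀ {n} (h : Fin n → Bool) (f : ℕ → Bool) → (∀ i → h i ≡ f (toℕ i)) → ∣ tabulate h ∣ ≡ count f n
∣tabulate∣ {zero}  h f eq = refl
∣tabulate∣ {suc n} h f eq with h zeroᶠ | eq zeroᶠ
... | true  | e rewrite sym e = cong suc (∣tabulate∣ (h ∘ sucᶠ) (f ∘ suc) (eq ∘ sucᶠ))
... | false | e rewrite sym e = ∣tabulate∣ (h ∘ sucᶠ) (f ∘ suc) (eq ∘ sucᶠ)

∣tabulate∣-≤ : ∀ {n} (h : Fin n → Bool) (f : ℕ → Bool) → (∀ i → h i ≡ true → f (toℕ i) ≡ true) → ∣ tabulate h ∣ ≤ count f n
∣tabulate∣-≤ {zero}  h f H = z≤n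
∣tabulate∣-≤ {suc n} h f H with h zeroᶠ | H zeroᶠ
... | true  | e rewrite e refl = s≤s (∣tabulate∣-≤ (h ∘ sucᶠ) (f ∘ suc) (H ∘ sucᶠ))
... | false | e = ≤-trans (∣tabulate∣-≤ (h ∘ sucᶠ) (f ∘ suc) (H ∘ sucᶠ)) (m≤n+m _ _)

-- Level counts of a vertex set and its border

does-true : ∀ {P : Set} (P? : Dec P) → does P? ≡ true → P
does-true (yes p) _ = p

module _ (q d : ℕ) (S : Subset (treeSize q d)) where

  border-intro : ∀ {u v} → u ∈ₛ S → Adj q (toℕ u) (toℕ v) →
                 lookup S v ≡ true ⊎ lookup (border q d S) v ≡ true
  border-intro {u} {v} u∈S adj with v ∈? S
  ... | yes v∈S = inj₁ ([]=⇒lookup v∈S)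
  ... | no  v∉S = inj₂ (trans (lookup∘tabulate _ v)
        (dec-true (¬? (v ∈? S) ×-dec any? (λ u → (u ∈? S) ×-dec adj? q (toℕ u) (toℕ v))) (v∉S , u , u∈S , adj)))

  border-elim : ∀ v → lookup (border q d S) v ≡ true → ¬ v ∈ₛ S × ∃ λ u → u ∈ₛ S × Adj q (toℕ u) (toℕ v)
  border-elim v e = does-true (¬? (v ∈? S) ×-dec any? (λ u → (u ∈? S) ×-dec adj? q (toℕ u) (toℕ v)))
                              (trans (sym (lookup∘tabulate _ v)) e)

count-levels : ∀ q f n → count f (T q n) ≡ Σ< (λ l → count (λ i → f (T q l + i)) (q ^ l)) n
count-levels q f zero    = refl
count-levels q f (suc n) = begin
  count f (T q (suc n))                                        ≡⟨ cong (count f) (T-suc q n) ⟩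
  count f (T q n + q ^ n)                                      ≡⟨ count-+ f (T q n) (q ^ n) ⟩
  count f (T q n) + count (λ i → f (T q n + i)) (q ^ n)        ≡⟨ cong (_+ count (λ i → f (T q n + i)) (q ^ n)) (count-levels q f n) ⟩
  Σ< (λ l → count (λ i → f (T q l + i)) (q ^ l)) (suc n)       ∎
  where open ≡-Reasoning

-- If t is the first index of a level, the next level starts at `suc (q * t)`, and the children of
-- the vertex at position i occupy the positions `i * q + j` there.
child-index : ∀ q t i j → suc (q * t) + (i * q + j) ≡ suc (q * (t + i)) + j
child-index = solve-∀

childOf-intro : ∀ q t i j → j < q → ChildOf q (t + i) (suc (q * t) + (i * q + j))
childOf-intro q t i j j<q rewrite child-index q t i j =
  m≤m+n _ j , ≤-trans (≤-reflexive (sym (+-suc _ j))) (+-monoʳ-≤ (q * (t + i)) j<q)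

module Levels (q d : ℕ) (0<q : 1 ≤ q) (S : Subset (treeSize q d)) where

  N : ℕ
  N = treeSize q d

  -- Beyond the tree everything counts as border, so that the relations below hold on all levels.
  inS inδ : ℕ → Bool
  inS = extend false S
  inδ = extend true (border q d S)

  a b : ℕ → ℕ
  a l = count (λ i → inS (T q l + i)) (q ^ l)
  b l = count (λ i → inδ (T q l + i)) (q ^ l)

  inS⇒∈ : ∀ u → inS u ≡ true → ∃ λ i → toℕ i ≡ u × i ∈ₛ S
  inS⇒∈ u e with u <? N
  ... | no u≮N with () ← trans (sym (extend-≥ false S u (≮⇒≥ u≮N))) e
  ... | yes u<N = fromℕ< u<N , toℕ-fromℕ< u<N , lookup⇒[]= _ S
        (trans (trans (sym (extend-toℕ false S (fromℕ< u<N))) (cong inS (toℕ-fromℕ< u<N))) e)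

  adjacent : ∀ u v → Adj q u v → inS u ≡ true → inS v ∨ inδ v ≡ true
  adjacent u v adj e with v <? N
  ... | no v≮N rewrite extend-≥ true (border q d S) v (≮⇒≥ v≮N) = ∨-zeroʳ (inS v)
  ... | yes v<N with inS⇒∈ u e
  ...   | i , refl , i∈S with border-intro q d S {i} {fromℕ< v<N} i∈S (subst (Adj q (toℕ i)) (sym (toℕ-fromℕ< v<N)) adj)
  ...     | inj₁ h rewrite trans (cong inS (sym (toℕ-fromℕ< v<N))) (trans (extend-toℕ false S (fromℕ< v<N)) h) = refl
  ...     | inj₂ h rewrite trans (cong inδ (sym (toℕ-fromℕ< v<N))) (trans (extend-toℕ true (border q d S) (fromℕ< v<N)) h) = ∨-zeroʳ (inS v)

  a₀≤1 : a 0 ≤ 1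
  a₀≤1 = count-≤ inS 1

  -- The parent of a vertex of S lies in S or in the border, and it has only q children.
  parents : ∀ l → a (suc l) ≤ q * (a l + b l)
  parents l = begin
    count (λ i → inS (T q (suc l) + i)) (q * q ^ l)       ≡⟨ cong (count _) (*-comm q (q ^ l)) ⟩
    count (λ i → inS (T q (suc l) + i)) (q ^ l * q)       ≤⟨ count-blocks-≤ q (q ^ l) _ (λ i → inS (T q l + i) ∨ inδ (T q l + i))
                                                               (λ i j j<q → adjacent _ (T q l + i) (inj₂ (childOf-intro q (T q l) i j j<q))) ⟩
    q * count (λ i → inS (T q l + i) ∨ inδ (T q l + i)) (q ^ l)  ≤⟨ scale q (count-∨ _ _ (q ^ l)) ⟩
    q * (a l + b l)                                       ∎
    where open ≤-Reasoning

  -- All q children of a vertex of S lie in S or in the border.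
  children : ∀ l → q * a l ≤ a (suc l) + b (suc l)
  children l = begin
    q * a l
      ≤⟨ count-blocks-≥ q (q ^ l) (λ i → inS (T q (suc l) + i) ∨ inδ (T q (suc l) + i)) (λ i → inS (T q l + i))
           (λ i j _ j<q → adjacent (T q l + i) _ (inj₁ (childOf-intro q (T q l) i j j<q))) ⟩
    count (λ i → inS (T q (suc l) + i) ∨ inδ (T q (suc l) + i)) (q ^ l * q)
      ≡⟨ cong (count _) (*-comm (q ^ l) q) ⟩
    count (λ i → inS (T q (suc l) + i) ∨ inδ (T q (suc l) + i)) (q ^ suc l)
      ≤⟨ count-∨ _ _ (q ^ suc l) ⟩
    a (suc l) + b (suc l) ∎
    where open ≤-Reasoning

  Σa≡ : Σ< a (suc d) ≡ ∣ S ∣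
  Σa≡ = trans (sym (count-levels q inS (suc d))) (trans (cong (count inS) (sym (treeSize≡T q d))) (count-extend false S))

  Σb≡ : Σ< b (suc d) ≡ ∣ border q d S ∣
  Σb≡ = trans (sym (count-levels q inδ (suc d))) (trans (cong (count inδ) (sym (treeSize≡T q d))) (count-extend true (border q d S)))

isoperimetric : ∀ q d n (S : Subset (treeSize q d)) → 3 ≤ q → ∣ S ∣ ≡ Σ< (T q) (suc d) →
  q * ∣ border q d S ∣ ≤ T q n + d → ∣ border q d S ∣ + suc d < T q n → suc d < ∣ border q d S ∣ + n
isoperimetric q d n S 3≤q ∣S∣≡ =
  subst (λ k → q * k ≤ T q n + d → k + suc d < T q n → suc d < k + n) Σb≡
    (border-lower-bound q 3≤q a b a₀≤1 parents children d n (trans Σa≡ ∣S∣≡))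
  where open Levels q d (≤-trans (s≤s z≤n) 3≤q) S

-- Realising profiles by vertex sets

-- The half-open interval from a to a + b: the second argument is a length.
between : ℕ → ℕ → ℕ → Bool
between zero    zero    i       = false
between zero    (suc b) zero    = true
between zero    (suc b) (suc i) = between zero b i
between (suc a) b       zero    = false
between (suc a) b       (suc i) = between a b i

between-true : ∀ a b i → a ≤ i → i < a + b → between a b i ≡ true
between-true zero    (suc b) zero    _         _         = refl
between-true zero    (suc b) (suc i) _         (s≤s i<b) = between-true zero b i z≤n i<b
between-true (suc a) b       (suc i) (s≤s a≤i) (s≤s i<)  = between-true a b i a≤i i<

between⇒< : ∀ b i → between 0 b i ≡ true → i < b
between⇒< (suc b) zero    _ = s≤s z≤n
between⇒< (suc b) (suc i) e = s≤s (between⇒< b i e)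

count-between-≤ : ∀ a b n → count (between a b) n ≤ b
count-between-≤ a       b       zero    = z≤n
count-between-≤ zero    zero    (suc n) = count-between-≤ zero zero n
count-between-≤ zero    (suc b) (suc n) = s≤s (count-between-≤ zero b n)
count-between-≤ (suc a) b       (suc n) = count-between-≤ a b n

count-below : ∀ b n → b ≤ n → count (between 0 b) n ≡ b
count-below zero    n       _         = n≤0⇒n≡0 (count-between-≤ 0 0 n)
count-below (suc b) (suc n) (s≤s b≤n) = cong suc (count-below b n b≤n)

glue : ℕ → (ℕ → Bool) → (ℕ → Bool) → ℕ → Bool
glue zero    f g i       = g i
glue (suc n) f g zero    = f zero
glue (suc n) f g (suc i) = glue n (f ∘ suc) g i

glue-left : ∀ n f g i → i < n → glue n f g i ≡ f i
glue-left (suc n) f g zero    _         = refl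
glue-left (suc n) f g (suc i) (s≤s i<n) = glue-left n (f ∘ suc) g i i<n

glue-right : ∀ n f g i → glue n f g (n + i) ≡ g i
glue-right zero    f g i = refl
glue-right (suc n) f g i = glue-right n (f ∘ suc) g i

count-glue : ∀ n m f g → count (glue n f g) (n + m) ≡ count f n + count g m
count-glue zero    m f g = refl
count-glue (suc n) m f g = trans (cong (indicator (f 0) +_) (count-glue n m (f ∘ suc) g)) (sym (+-assoc (indicator (f 0)) _ _))

-- Profile q l a b S K: a union of initial segments of the levels 0 … l, of total size S, whose last
-- segment has size a.  It has at most K border vertices on the levels 0 … l - 1, and those of level l
-- that are children of its vertices number at most b.
data Profile (q : ℕ) : (l a b S K : ℕ) → Set where
  root : ∀ {a} → a ≤ 1 → Profile q 0 a 0 a 0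
  step : ∀ {l a b S K} a′ {b′ S′ K′} b₁ → Profile q l a b S K → b ≤ b₁ →
         a′ ≤ q * (a + b₁) → q * a ≤ a′ + b′ → a′ ≤ q ^ suc l →
         S + a′ ≡ S′ → K + b₁ ≤ K′ → Profile q (suc l) a′ b′ S′ K′

module Realise (q : ℕ) (0<q : 1 ≤ q) where

  member : ∀ {l a b S K} → Profile q l a b S K → ℕ → Bool
  member (root {a} _)                         = between 0 a
  member (step {l} a′ _ p _ _ _ _ _ _) = glue (T q (suc l)) (member p) (between 0 a′)

  -- A superset of the border: on each level, the positions directly after the segment. Their number
  -- `b₁` is fixed only when the next level is chosen, since it has to include both the children of
  -- the level above and the parents of the next segment. For the last level it is c.
  cover : ∀ {l a b S K} → Profile q l a b S K → ℕ → ℕ → Bool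
  cover (root {a} _)                   c = between a c
  cover (step {l} a′ b₁ p _ _ _ _ _ _) c = glue (T q (suc l)) (cover p b₁) (between a′ c)

  member-last : ∀ {l a b S K} (p : Profile q l a b S K) i → member p (T q l + i) ≡ between 0 a i
  member-last (root _)                   i = refl
  member-last (step {l} a′ _ p _ _ _ _ _ _) i = glue-right (T q (suc l)) (member p) (between 0 a′) i

  cover-last : ∀ {l a b S K} (p : Profile q l a b S K) c i → cover p c (T q l + i) ≡ between a c i
  cover-last (root _)                   c i = refl
  cover-last (step {l} a′ b₁ p _ _ _ _ _ _) c i = glue-right (T q (suc l)) (cover p b₁) (between a′ c) i

  count-member : ∀ {l a b S K} (p : Profile q l a b S K) → count (member p) (T q (suc l)) ≡ S
  count-member (root {a} a≤1) rewrite *-zeroʳ q = count-below a 1 a≤1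
  count-member (step {l} {S = S} a′ {S′ = S′} b₁ p _ _ _ a′≤ S≡ _) = begin
    count f (T q (suc (suc l)))                                           ≡⟨ cong (count f) (T-suc q (suc l)) ⟩
    count f (T q (suc l) + q ^ suc l)                                     ≡⟨ count-glue (T q (suc l)) (q ^ suc l) (member p) (between 0 a′) ⟩
    count (member p) (T q (suc l)) + count (between 0 a′) (q ^ suc l)     ≡⟨ cong₂ _+_ (count-member p) (count-below a′ (q ^ suc l) a′≤) ⟩
    S + a′                                                                ≡⟨ S≡ ⟩
    S′ ∎
    where
    open ≡-Reasoning
    f : ℕ → Bool
    f = glue (T q (suc l)) (member p) (between 0 a′)

  -- Only an inequality, as an interval of the cover may extend past the end of its level.
  count-cover : ∀ {l a b S K} (p : Profile q l a b S K) c → count (cover p c) (T q (suc l)) ≤ K + c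
  count-cover (root {a} _) c rewrite *-zeroʳ q = count-between-≤ a c 1
  count-cover (step {l} {K = K} a′ {K′ = K′} b₁ p _ _ _ _ _ K≤) c = begin
    count g (T q (suc (suc l)))                                           ≡⟨ cong (count g) (T-suc q (suc l)) ⟩
    count g (T q (suc l) + q ^ suc l)                                     ≡⟨ count-glue (T q (suc l)) (q ^ suc l) (cover p b₁) (between a′ c) ⟩
    count (cover p b₁) (T q (suc l)) + count (between a′ c) (q ^ suc l)   ≤⟨ +-mono-≤ (count-cover p b₁) (count-between-≤ a′ c (q ^ suc l)) ⟩
    K + b₁ + c                                                            ≤⟨ +-monoˡ-≤ c K≤ ⟩
    K′ + c ∎
    where
    open ≤-Reasoning
    g : ℕ → Bool
    g = glue (T q (suc l)) (cover p b₁) (between a′ c)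

  child-position : ∀ l {u v} → ChildOf q u v → T q (suc l) ≤ v → v < T q (suc (suc l)) →
                   ∃₂ λ i j → j < q × T q l + i < T q (suc l) × u ≡ T q l + i × v ≡ T q (suc l) + (q * i + j)
  child-position l {u} {v} (lo , hi) T≤v v<T = i , j , j<q , subst (_< T q (suc l)) u≡ u<T , u≡ , v≡
    where
    T≤u : T q l ≤ u
    T≤u = ≤-pred (*-cancelˡ-< q _ _ (≤-trans T≤v (≤-trans hi (≤-reflexive (trans (+-comm (q * u) q) (sym (*-suc q u)))))))
    u<T : u < T q (suc l)
    u<T = *-cancelˡ-< q _ _ (≤-trans lo (≤-pred v<T))
    i j : ℕ
    i = u ∸ T q l
    j = v ∸ suc (q * u)
    u≡ : u ≡ T q l + i
    u≡ = sym (m+[n∸m]≡n T≤u)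
    j-spec : suc (q * u) + j ≡ v
    j-spec = m+[n∸m]≡n lo
    j<q : j < q
    j<q = +-cancelˡ-≤ (q * u) (suc j) q (≤-trans (≤-reflexive (trans (+-suc (q * u) j) j-spec)) hi)
    v≡ : v ≡ T q (suc l) + (q * i + j)
    v≡ = trans (sym j-spec) (trans (cong (λ u → suc (q * u) + j) u≡) (regroup q (T q l) i j))
      where
      regroup : ∀ q t i j → suc (q * (t + i)) + j ≡ suc (q * t) + (q * i + j)
      regroup = solve-∀

  -- Children of the first a positions fill the first q a positions of the next level, which lie in
  -- the segment or the cover because q a ≤ a′ + b′. Conversely, the first a′ positions have their
  -- parents among the first a + b₁, because a′ ≤ q (a + b₁).
  covered : ∀ {l a b S K} (p : Profile q l a b S K) c → b ≤ c → ∀ u v → v < T q (suc l) → ChildOf q u v →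
    (member p u ≡ true → member p v ≡ true ⊎ cover p c v ≡ true) ×
    (member p v ≡ true → member p u ≡ true ⊎ cover p c u ≡ true)
  covered (root _) c _ u v v<1 (lo , _) rewrite *-zeroʳ q =
    ⊥-elim (n≮n 1 (≤-trans (s≤s (≤-trans (s≤s z≤n) lo)) v<1))
  covered (step {l} {a} a′ {b′} b₁ p b≤b₁ a′≤ qa≤ _ _ _) c b′≤c u v v<T ch@(lo , hi) with v <? T q (suc l)
  ... | yes v<T′ rewrite glue-left (T q (suc l)) (member p) (between 0 a′) v v<T′
                       | glue-left (T q (suc l)) (cover p b₁) (between a′ c) v v<T′
                       | glue-left (T q (suc l)) (member p) (between 0 a′) u (≤-<-trans (m≤n*m u q {{>-nonZero 0<q}}) (<-trans lo v<T′))
                       | glue-left (T q (suc l)) (cover p b₁) (between a′ c) u (≤-<-trans (m≤n*m u q {{>-nonZero 0<q}}) (<-trans lo v<T′))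
                       = covered p b₁ b≤b₁ u v v<T′ ch
  ... | no v≮T′ with child-position l ch (≮⇒≥ v≮T′) v<T
  ...   | i , j , j<q , u<T , refl , refl
          rewrite glue-right (T q (suc l)) (member p) (between 0 a′) (q * i + j)
                | glue-right (T q (suc l)) (cover p b₁) (between a′ c) (q * i + j)
                | glue-left (T q (suc l)) (member p) (between 0 a′) (T q l + i) u<T
                | glue-left (T q (suc l)) (cover p b₁) (between a′ c) (T q l + i) u<T
                | member-last p i
                | cover-last p b₁ i
                = down , up
    where
    slot : ∀ m → i < m → q * i + j < q * m
    slot m i<m = ≤-trans (≤-reflexive (sym (+-suc (q * i) j))) (≤-trans (+-monoʳ-≤ (q * i) j<q)
      (≤-trans (≤-reflexive (trans (+-comm (q * i) q) (sym (*-suc q i)))) (scale q i<m)))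
    down : between 0 a i ≡ true → between 0 a′ (q * i + j) ≡ true ⊎ between a′ c (q * i + j) ≡ true
    down e with (q * i + j) <? a′
    ... | yes k<a′ = inj₁ (between-true 0 a′ _ z≤n k<a′)
    ... | no  k≮a′ = inj₂ (between-true a′ c _ (≮⇒≥ k≮a′)
                       (≤-trans (slot a (between⇒< a i e)) (≤-trans qa≤ (+-monoʳ-≤ a′ b′≤c))))
    up : between 0 a′ (q * i + j) ≡ true → between 0 a i ≡ true ⊎ between a b₁ i ≡ true
    up e with i <? a
    ... | yes i<a = inj₁ (between-true 0 a i z≤n i<a)
    ... | no  i≮a = inj₂ (between-true a b₁ i (≮⇒≥ i≮a)
                      (*-cancelˡ-< q _ _ (≤-<-trans (m≤m+n (q * i) j) (≤-trans (between⇒< a′ _ e) a′≤))))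

  realise : ∀ {d a b s k} → Profile q d a b s k → ∃ λ (S : Subset (treeSize q d)) → ∣ S ∣ ≡ s × ∣ border q d S ∣ ≤ k + b
  realise {d} {b = b} {s} {k} p = S , size , small
    where
    S : Subset (treeSize q d)
    S = tabulate (member p ∘ toℕ)
    size : ∣ S ∣ ≡ s
    size = trans (∣tabulate∣ {treeSize q d} _ (member p) (λ _ → refl)) (trans (cong (count (member p)) (treeSize≡T q d)) (count-member p))
    member-∈ : ∀ {i} → i ∈ₛ S → member p (toℕ i) ≡ true
    member-∈ {i} i∈S = trans (sym (lookup∘tabulate (member p ∘ toℕ) i)) ([]=⇒lookup i∈S)
    v<T : (v : Fin (treeSize q d)) → toℕ v < T q (suc d)
    v<T v = subst (toℕ v <_) (treeSize≡T q d) (toℕ<n v)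
    in-cover : ∀ v → lookup (border q d S) v ≡ true → cover p b (toℕ v) ≡ true
    in-cover v e with border-elim q d S v e
    ... | v∉S , u , u∈S , adj = resolve (neighbour adj)
      where
      resolve : member p (toℕ v) ≡ true ⊎ cover p b (toℕ v) ≡ true → cover p b (toℕ v) ≡ true
      resolve (inj₁ m) = ⊥-elim (v∉S (lookup⇒[]= v S (trans (lookup∘tabulate _ v) m)))
      resolve (inj₂ h) = h
      neighbour : Adj q (toℕ u) (toℕ v) → member p (toℕ v) ≡ true ⊎ cover p b (toℕ v) ≡ true
      neighbour (inj₁ ch) = proj₁ (covered p b ≤-refl (toℕ u) (toℕ v) (v<T v) ch) (member-∈ u∈S)
      neighbour (inj₂ ch) = proj₂ (covered p b ≤-refl (toℕ v) (toℕ u) (v<T u) ch) (member-∈ u∈S)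
    small : ∣ border q d S ∣ ≤ k + b
    small = ≤-trans (∣tabulate∣-≤ _ (cover p b) (λ i e → in-cover i (trans (lookup∘tabulate _ i) e)))
              (≤-trans (≤-reflexive (cong (count (cover p b)) (treeSize≡T q d))) (count-cover p b))

-- Greedy expansion in repunits

-- As long as r vertices remain to be placed, the level is not full, so there is a further vertex
-- whose children can be added below.
Room : ℕ → ℕ → ℕ → ℕ → Set
Room q l a r = a ≤ q ^ l × (1 ≤ r → a < q ^ l)

-- One greedy digit: X new vertices on level l + 1, each the root of a subtree with T_{j+1}
-- vertices. The digit q occurs only with remainder 0.
record Digit (q j l a r : ℕ) : Set where
  constructor digit
  field
    X r′      : ℕ
    r≡        : r ≡ X * T q (suc j) + r′
    r′≤       : r′ ≤ q * T q j
    X≤q       : X ≤ q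
    X<q       : 1 ≤ r′ → X < q
    1≤r       : 1 ≤ X → 1 ≤ r
    room      : Room q (suc l) (q * a + X) r′

greedy-digit : ∀ q j l a r → Room q l a r → r ≤ q * T q (suc j) → Digit q j l a r
greedy-digit q j l a r (a≤ , a<) r≤ = digit X r′ r≡ (≤-pred (m%n<n r t)) X≤q X<q 1≤r room
  where
  t X r′ : ℕ
  t = T q (suc j)
  X = r / t
  r′ = r % t
  r≡ : r ≡ X * t + r′
  r≡ = trans (m≡m%n+[m/n]*n r t) (+-comm r′ (X * t))
  Xt≤ : X * t + r′ ≤ q * t
  Xt≤ = ≤-trans (≤-reflexive (sym r≡)) r≤
  X≤q : X ≤ q
  X≤q = *-cancelʳ-≤ X q t (≤-trans (m≤m+n (X * t) r′) Xt≤)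
  X<q : 1 ≤ r′ → X < q
  X<q 1≤r′ = *-cancelʳ-< t X q (≤-trans (≤-reflexive (+-comm 1 (X * t))) (≤-trans (+-monoʳ-≤ (X * t) 1≤r′) Xt≤))
  1≤r : 1 ≤ X → 1 ≤ r
  1≤r 1≤X = ≤-trans 1≤X (≤-trans (m≤m*n X t) (≤-trans (m≤m+n (X * t) r′) (≤-reflexive (sym r≡))))
  next : ∀ y → a < q ^ l → y ≤ q → q * a + y ≤ q ^ suc l
  next y a<q^l y≤q = ≤-trans (+-monoʳ-≤ (q * a) y≤q)
    (≤-trans (≤-reflexive (trans (+-comm (q * a) q) (sym (*-suc q a)))) (scale q a<q^l))
  room₁ : ∀ y → y ≤ q → (1 ≤ y → 1 ≤ r) → q * a + y ≤ q ^ suc l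
  room₁ zero    y≤q h = ≤-trans (≤-reflexive (+-identityʳ (q * a))) (scale q a≤)
  room₁ (suc y) y≤q h = next (suc y) (a< (h (s≤s z≤n))) y≤q
  room₂ : 1 ≤ r′ → q * a + X < q ^ suc l
  room₂ 1≤r′ = ≤-trans (≤-reflexive (sym (+-suc (q * a) X)))
    (next (suc X) (a< (≤-trans 1≤r′ (≤-trans (m≤n+m r′ (X * t)) (≤-reflexive (sym r≡))))) (X<q 1≤r′))
  room : Room q (suc l) (q * a + X) r′
  room = room₁ X X≤q 1≤r , room₂

module Construction (q : ℕ) (0<q : 1 ≤ q) where

  Reach : (l a S K : ℕ) → Set
  Reach l a S K = Profile q l a 0 S K

  Done : (d s k : ℕ) → Set
  Done d s k = ∃ λ a → Reach d a s k

  slots : ∀ q a X b → X ≤ q * b → q * a + X ≤ q * (a + b)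
  slots q a X b h = ≤-trans (+-monoʳ-≤ (q * a) h) (≤-reflexive (sym (*-distribˡ-+ q a b)))

  -- The X new vertices are children of a single vertex outside S, the only border vertex charged.
  digit-step : ∀ {l a S K} X → Reach l a S K → X ≤ q → q * a + X ≤ q ^ suc l →
               Reach (suc l) (q * a + X) (S + (q * a + X)) (suc K)
  digit-step {a = a} {K = K} X p X≤q cap = step (q * a + X) 1 p z≤n
    (slots q a X 1 (≤-trans X≤q (≤-reflexive (sym (*-identityʳ q)))))
    (≤-trans (m≤m+n (q * a) X) (m≤m+n _ 0)) cap refl (≤-reflexive (+-comm K 1))

  zero-step : ∀ {l a S K} → Reach l a S K → a ≤ q ^ l → Reach (suc l) (q * a) (S + q * a) K
  zero-step {a = a} {K = K} p cap = step (q * a) 0 p z≤n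
    (≤-reflexive (cong (q *_) (sym (+-identityʳ a)))) (m≤m+n _ 0) (scale q cap) refl (≤-reflexive (+-identityʳ K))

  zeros : ∀ d j l a S K → l + j ≡ d → Reach l a S K → a ≤ q ^ l → Done d (S + a * (q * T q j)) K
  zeros d zero    l a S K refl p cap rewrite +-identityʳ l | *-zeroʳ q | *-zeroʳ a | +-identityʳ S = a , p
  zeros d (suc j) l a S K e p cap =
    subst (λ s → Done d s K) (total q a (T q j) S)
      (zeros d j (suc l) (q * a) (S + q * a) K (trans (sym (+-suc l j)) e) (zero-step p cap) (scale q cap))
    where
    total : ∀ q a t S → S + q * a + q * a * (q * t) ≡ S + a * (q * suc (q * t))
    total = solve-∀

  digit-total : ∀ q a X t S r′ → S + (q * a + X) + (q * a + X) * (q * t) + r′ ≡ S + a * (q * suc (q * t)) + (X * suc (q * t) + r′)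
  digit-total = solve-∀

  -- Invariant: `S + a * (q * T q j)` is the size obtained by adding all descendants of the last
  -- segment, and r is what is then still missing.
  greedy : ∀ d j l a S K r → l + j ≡ d → Reach l a S K → Room q l a r → r ≤ q * T q j →
           Done d (S + a * (q * T q j) + r) (K + j)
  greedy d zero    l a S K r refl p room r≤ rewrite n≤0⇒n≡0 (≤-trans r≤ (≤-reflexive (*-zeroʳ q))) | +-identityʳ l
    | *-zeroʳ q | *-zeroʳ a | +-identityʳ S | +-identityʳ S | +-identityʳ K = a , p
  greedy d (suc j) l a S K r e p room r≤ with greedy-digit q j l a r room r≤
  ... | digit X r′ refl r′≤ X≤q _ _ room′ =
    subst₂ (Done d) (digit-total q a X (T q j) S r′) (sym (+-suc K j))
      (greedy d j (suc l) (q * a + X) _ (suc K) r′ (trans (sym (+-suc l j)) e) (digit-step X p X≤q (proj₁ room′)) room′ r′≤)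

  -- The greedy expansion stopped on level m with j levels to go. The last field shows that an empty
  -- last segment leaves s = r, hence s small.
  record Prefix (m j K s : ℕ) : Set where
    constructor prefix
    field
      a S r   : ℕ
      reach   : Reach m a S K
      room    : Room q m a r
      r≤      : r ≤ q * T q j
      total   : S + a * (q * T q j) + r ≡ s
      a≡0⇒S≡0 : a ≡ 0 → S ≡ 0

  greedy-prefix : ∀ n j m l a S K r → l + n ≡ m → Reach l a S K → Room q l a r → r ≤ q * T q (n + j) →
                  (a ≡ 0 → S ≡ 0) → Prefix m j (K + n) (S + a * (q * T q (n + j)) + r)
  greedy-prefix zero    j m l a S K r refl p room r≤ h rewrite +-identityʳ l | +-identityʳ K = prefix a S r p room r≤ refl h
  greedy-prefix (suc n) j m l a S K r e p room r≤ h with greedy-digit q (n + j) l a r room r≤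
  ... | digit X r′ refl r′≤ X≤q _ _ room′ =
    subst₂ (Prefix m j) (sym (+-suc K n)) (digit-total q a X (T q (n + j)) S r′)
      (greedy-prefix n j m (suc l) (q * a + X) _ (suc K) r′ (trans (sym (+-suc l n)) e)
        (digit-step X p X≤q (proj₁ room′)) room′ r′≤ (λ e → cong₂ _+_ (h (a≡0 e)) e))
    where
    a≡0 : q * a + X ≡ 0 → a ≡ 0
    a≡0 e = n≤0⇒n≡0 (≤-trans (m≤n*m a q {{>-nonZero 0<q}}) (≤-trans (m≤m+n (q * a) X) (≤-reflexive e)))

  -- Changing the size by one within three levels

  module _ {l a S K : ℕ} (X₀ X₁ X₂ : ℕ) (p : Reach l a S K) where

    private
      a₁ a₂ a₃ : ℕ
      a₁ = q * a + X₀
      a₂ = q * a₁ + X₁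
      a₃ = q * a₂ + X₂

    module _ (a₂≤ : a₂ ≤ q ^ (2 + l)) (a₃≤ : a₃ ≤ q ^ (3 + l)) (X₂≤q : X₂ ≤ q) where

      neutral-block : X₀ ≤ q → X₁ ≤ q → a₁ ≤ q ^ suc l → Reach (3 + l) a₃ (S + a₁ + a₂ + a₃) (3 + K)
      neutral-block X₀≤q X₁≤q a₁≤ = digit-step X₂ (digit-step X₁ (digit-step X₀ p X₀≤q a₁≤) X₁≤q a₂≤) X₂≤q a₃≤

      -- One vertex more on level l + 1; the three levels then cost 1, 0 and 2 border vertices.
      up-block : X₀ < q → q ≤ X₁ + 2 → X₁ ≤ q → a₁ < q ^ suc l → Reach (3 + l) a₃ (suc (S + a₁ + a₂ + a₃)) (3 + K)
      up-block X₀<q q≤X₁+2 X₁≤q a₁< = subst₂ (Reach (3 + l) a₃) (total S a₁ a₂ a₃) (+-comm K 3)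
        -- The extra vertex already supplies parents for the X₁ new vertices. Its q - X₁ ≤ 2 missing
        -- children are border vertices, and the first position after the segment also serves as
        -- parent for the X₂ vertices below.
        (step a₃ 2
          (step a₂ {b′ = 2} 0
            (step (suc a₁) {b′ = 0} 1 p z≤n
              (≤-trans (≤-reflexive (sym (+-suc (q * a) X₀))) (slots q a (suc X₀) 1 (≤-trans X₀<q (≤-reflexive (sym (*-identityʳ q))))))
              (lemma₁ q a X₀)
              a₁< refl ≤-refl)
            z≤n (lemma₂ q a₁ X₁ X₁≤q) (lemma₃ q a₁ X₁ q≤X₁+2) a₂≤ refl ≤-refl)
          ≤-refl (slots q a₂ X₂ 2 (≤-trans X₂≤q (m≤m*n q 2))) (≤-trans (m≤m+n (q * a₂) X₂) (m≤m+n _ 0)) a₃≤ refl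
          (≤-reflexive (sum K)))
        where
        total : ∀ S a₁ a₂ a₃ → S + suc a₁ + a₂ + a₃ ≡ suc (S + a₁ + a₂ + a₃)
        total = solve-∀
        sum : ∀ K → K + 1 + 0 + 2 ≡ K + 3
        sum = solve-∀
        lemma₁ : ∀ q a X → q * a ≤ suc (q * a + X) + 0
        lemma₁ q a X = ≤-trans (m≤m+n (q * a) X) (≤-trans (n≤1+n _) (m≤m+n _ 0))
        lemma₂ : ∀ q a X → X ≤ q → q * a + X ≤ q * (suc a + 0)
        lemma₂ q a X h = farkas h 0 (solve (q ∷ a ∷ X ∷ []))
        lemma₃ : ∀ q a X → q ≤ X + 2 → q * suc a ≤ q * a + X + 2
        lemma₃ q a X h = farkas h 0 (solve (q ∷ a ∷ X ∷ []))

      -- One vertex less on level l + 2; again the costs are 1, 0 and 2.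
      down-block : X₀ ≤ q → X₁ ≤ 1 → a₁ ≤ q ^ suc l → ∀ m → suc m ≡ a₂ → Reach (3 + l) a₃ (S + a₁ + m + a₃) (3 + K)
      down-block X₀≤q X₁≤1 a₁≤ m m≡ = subst (Reach (3 + l) a₃ (S + a₁ + m + a₃)) (+-comm K 3)
        -- As X₁ ≤ 1, the m = a₂ - 1 vertices have all their parents in S. The positions m and m + 1
        -- then supply the parents that a₃ requires.
        (step a₃ 2
          (step m {b′ = 1} 0
            (digit-step X₀ p X₀≤q a₁≤)
            z≤n (lemma₁ q a₁ X₁ m X₁≤1 m≡) (lemma₂ q a₁ X₁ m m≡)
            (≤-trans (n≤1+n m) (≤-trans (≤-reflexive m≡) a₂≤)) refl ≤-refl)
          (s≤s z≤n) (lemma₃ q a₂ X₂ m m≡ X₂≤q 0<q) (lemma₄ q a₂ X₂ m m≡) a₃≤ refl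
          (≤-reflexive (sum K)))
        where
        sum : ∀ K → suc K + 0 + 2 ≡ K + 3
        sum = solve-∀
        lemma₁ : ∀ q a X m → X ≤ 1 → suc m ≡ q * a + X → m ≤ q * (a + 0)
        lemma₁ q a X m h e = farkas (+-mono-≤ h (≤-reflexive e)) 0 (solve (q ∷ a ∷ X ∷ m ∷ []))
        lemma₂ : ∀ q a X m → suc m ≡ q * a + X → q * a ≤ m + 1
        lemma₂ q a X m e = farkas (≤-reflexive (sym e)) X (solve (q ∷ a ∷ X ∷ m ∷ []))
        lemma₃ : ∀ q a X m → suc m ≡ a → X ≤ q → 1 ≤ q → q * a + X ≤ q * (m + 2)
        lemma₃ q .(suc m) X m refl h _ = farkas h 0 (solve (q ∷ X ∷ m ∷ []))
        lemma₄ : ∀ q a X m → suc m ≡ a → q * m ≤ q * a + X + 0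
        lemma₄ q .(suc m) X m refl = ≤-trans (scale q (n≤1+n m)) (≤-trans (m≤m+n _ X) (m≤m+n _ 0))

  -- Rounding the truncated expansion

  -- All sizes from S - down to S + up occur with the same last segment and the same cost, so the
  -- expansion can continue independently of the choice.
  Spread : (l a S K up down : ℕ) → Set
  Spread l a S K up down =
    (∀ u → u ≤ up → Reach l a (S + u) K) ×
    (∀ u → u ≤ down → ∃ λ S′ → S′ + u ≡ S × Reach l a S′ K)

  module _ (q≤4 : q ≤ 4) where

    -- Each of the i blocks enlarges `up` or `down` by one, so in the end T_{L+1} ≤ 1 + up + down.
    -- The final remainder r′ < T_{L+1} is then either at most `up`, and is placed higher up, or
    -- T_{L+1} - r′ is at most `down`, and the last digit is rounded up. Either way the last L
    -- levels are free.
    blocks : ∀ d L i l a S K r up down → l + (i * 3 + suc L) ≡ d → 1 ≤ a → Room q l a r →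
             r ≤ q * T q (i * 3 + suc L) → T q (suc L) ≤ suc (up + down + i) → Spread l a S K up down →
             Done d (S + a * (q * T q (i * 3 + suc L)) + r) (K + (i * 3 + 1))
    blocks d L zero l a S K r up down e 1≤a room r≤ enough (ups , downs) with greedy-digit q L l a r room r≤
    ... | digit X r′ refl r′≤ X≤q X<q _ (cap , cap<) with r′ ≤? up
    ...   | yes r′≤up = subst₂ (Done d) (total q a X (T q L) S r′) (+-comm 1 K)
              (zeros d L (suc l) (q * a + X) (S + r′ + (q * a + X)) (suc K) (trans (sym (+-suc l L)) e)
                (digit-step X (ups r′ r′≤up) X≤q cap) cap)
      where
      total : ∀ q a X t S r → S + r + (q * a + X) + (q * a + X) * (q * t) ≡ S + a * (q * suc (q * t)) + (X * suc (q * t) + r)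
      total = solve-∀
    ...   | no r′≰up with downs (T q (suc L) ∸ r′) u≤down
      where
      u≤down : T q (suc L) ∸ r′ ≤ down
      u≤down = m≤n+o⇒m∸n≤o (T q (suc L)) r′ (≤-trans enough (≤-trans (≤-reflexive (cong suc (+-identityʳ (up + down)))) (+-monoˡ-≤ down (≰⇒> r′≰up))))
    ...     | S′ , refl , p = subst₂ (Done d) (total q a X (T q L) S′ (T q (suc L) ∸ r′) r′ (m∸n+n≡m (≤-trans r′≤ (n≤1+n _)))) (+-comm 1 K)
              (zeros d L (suc l) (q * a + suc X) (S′ + (q * a + suc X)) (suc K) (trans (sym (+-suc l L)) e)
                (digit-step (suc X) p (X<q 1≤r′) cap′) cap′)
      where
      1≤r′ : 1 ≤ r′
      1≤r′ = ≤-trans (s≤s z≤n) (≰⇒> r′≰up)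
      cap′ : q * a + suc X ≤ q ^ suc l
      cap′ = ≤-trans (≤-reflexive (+-suc (q * a) X)) (cap< 1≤r′)
      total : ∀ q a X t S u r → u + r ≡ suc (q * t) →
              S + (q * a + suc X) + (q * a + suc X) * (q * t) ≡ S + u + a * (q * suc (q * t)) + (X * suc (q * t) + r)
      total q a X t S u r e = trans (before q a X t S) (trans (cong (λ y → S + a * (q * suc (q * t)) + X * suc (q * t) + y) (sym e)) (after (q * suc (q * t)) (suc (q * t)) a X S u r))
        where
        before : ∀ q a X t S → S + (q * a + suc X) + (q * a + suc X) * (q * t) ≡ S + a * (q * suc (q * t)) + X * suc (q * t) + suc (q * t)
        before = solve-∀
        after : ∀ w y a X S u r → S + a * w + X * y + (u + r) ≡ S + u + a * w + (X * y + r)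
        after = solve-∀
    blocks d L (suc i) l a S K r up down e 1≤a room r≤ enough (ups , downs)
      with greedy-digit q (2 + i * 3 + suc L) l a r room r≤
    ... | digit X₀ _ refl r₁≤ X₀≤q X₀<q _ room₁ with greedy-digit q (1 + i * 3 + suc L) (suc l) (q * a + X₀) _ room₁ r₁≤
    ... | digit X₁ _ refl r₂≤ X₁≤q X₁<q 1≤r₁ room₂ with greedy-digit q (i * 3 + suc L) (2 + l) (q * (q * a + X₀) + X₁) _ room₂ r₂≤
    ... | digit X₂ r₃ refl r₃≤ X₂≤q X₂<q _ room₃ = finish (X₁ ≤? 1)
      where
      a₁ a₂ a₃ S₃ j : ℕ
      a₁ = q * a + X₀
      a₂ = q * a₁ + X₁
      a₃ = q * a₂ + X₂
      S₃ = S + a₁ + a₂ + a₃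
      j = i * 3 + suc L
      1≤a₂ : 1 ≤ a₂
      1≤a₂ = ≤-trans (≤-trans (≤-trans 1≤a (m≤n*m a q {{>-nonZero 0<q}})) (m≤m+n (q * a) X₀))
                     (≤-trans (m≤n*m a₁ q {{>-nonZero 0<q}}) (m≤m+n (q * a₁) X₁))
      1≤a₃ : 1 ≤ a₃
      1≤a₃ = ≤-trans 1≤a₂ (≤-trans (m≤n*m a₂ q {{>-nonZero 0<q}}) (m≤m+n (q * a₂) X₂))
      level : 3 + l + j ≡ d
      level = trans (shift l j) e
        where
        shift : ∀ l j → 3 + l + j ≡ l + (3 + j)
        shift = solve-∀
      K-total : ∀ K n → 3 + K + n ≡ K + (3 + n)
      K-total = solve-∀
      neutral : ∀ {S} → Reach l a S K → Reach (3 + l) a₃ (S + a₁ + a₂ + a₃) (3 + K)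
      neutral p = neutral-block X₀ X₁ X₂ p (proj₁ room₂) (proj₁ room₃) X₂≤q X₀≤q X₁≤q (proj₁ room₁)
      commute : ∀ S u b c e → S + u + b + c + e ≡ S + b + c + e + u
      commute = solve-∀
      ups′ : ∀ u → u ≤ up → Reach (3 + l) a₃ (S₃ + u) (3 + K)
      ups′ u u≤ = subst (λ s → Reach (3 + l) a₃ s (3 + K)) (commute S u a₁ a₂ a₃) (neutral (ups u u≤))
      downs′ : ∀ u → u ≤ down → ∃ λ S′ → S′ + u ≡ S₃ × Reach (3 + l) a₃ S′ (3 + K)
      downs′ u u≤ with downs u u≤
      ... | S′ , eq , p = S′ + a₁ + a₂ + a₃ , trans (sym (commute S′ u a₁ a₂ a₃)) (cong (λ s → s + a₁ + a₂ + a₃) eq) , neutral p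
      continue : ∀ up down → T q (suc L) ≤ suc (up + down + i) → Spread (3 + l) a₃ S₃ (3 + K) up down →
                 Done d (S + a * (q * T q (3 + j)) + (X₀ * T q (3 + j) + (X₁ * T q (2 + j) + (X₂ * T q (1 + j) + r₃)))) (K + (3 + i * 3 + 1))
      continue up down enough spread = subst₂ (Done d)
        (trans (digit-total q a₂ X₂ (T q j) (S + a₁ + a₂) r₃)
          (trans (digit-total q a₁ X₁ (T q (1 + j)) (S + a₁) (X₂ * T q (1 + j) + r₃))
            (digit-total q a X₀ (T q (2 + j)) S (X₁ * T q (2 + j) + (X₂ * T q (1 + j) + r₃)))))
        (K-total K (i * 3 + 1))
        (blocks d L i (3 + l) a₃ S₃ (3 + K) r₃ up down level 1≤a₃ room₃ r₃≤ enough spread)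
      -- Here q ≤ 4 enters: a digit that is not at most 1 is at least 2, hence at least q - 2.
      finish : Dec (X₁ ≤ 1) → _
      finish (yes X₁≤1) = continue up (suc down) (≤-trans enough (≤-reflexive (regroup up down i))) (ups′ , downs″)
        where
        regroup : ∀ u d i → suc (u + d + suc i) ≡ suc (u + suc d + i)
        regroup = solve-∀
        downs″ : ∀ u → u ≤ suc down → ∃ λ S′ → S′ + u ≡ S₃ × Reach (3 + l) a₃ S′ (3 + K)
        downs″ zero    _         = downs′ zero z≤n
        downs″ (suc u) (s≤s u≤) with downs u u≤
        ... | S′ , eq , p = S′ + a₁ + pred a₂ + a₃ ,
            trans (shift S′ a₁ (pred a₂) a₃ u) (cong₂ (λ s y → s + a₁ + y + a₃) eq 1+pred) ,
            down-block X₀ X₁ X₂ p (proj₁ room₂) (proj₁ room₃) X₂≤q X₀≤q X₁≤1 (proj₁ room₁) (pred a₂) 1+pred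
          where
          1+pred : suc (pred a₂) ≡ a₂
          1+pred = suc-pred a₂ {{>-nonZero 1≤a₂}}
          shift : ∀ S b m c u → S + b + m + c + suc u ≡ S + u + b + suc m + c
          shift = solve-∀
      finish (no X₁≰1) = continue (suc up) down (≤-trans enough (≤-reflexive (regroup up down i))) (ups″ , downs′)
        where
        regroup : ∀ u d i → suc (u + d + suc i) ≡ suc (suc u + d + i)
        regroup = solve-∀
        1≤r : _
        1≤r = 1≤r₁ (≤-trans (s≤s z≤n) (≰⇒> X₁≰1))
        q≤X₁+2 : q ≤ X₁ + 2
        q≤X₁+2 = ≤-trans q≤4 (+-monoˡ-≤ 2 (≰⇒> X₁≰1))
        ups″ : ∀ u → u ≤ suc up → Reach (3 + l) a₃ (S₃ + u) (3 + K)
        ups″ zero    _        = ups′ zero z≤n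
        ups″ (suc u) (s≤s u≤) = subst (λ s → Reach (3 + l) a₃ s (3 + K)) (shift S u a₁ a₂ a₃)
          (up-block X₀ X₁ X₂ (ups u u≤) (proj₁ room₂) (proj₁ room₃) X₂≤q (X₀<q 1≤r) q≤X₁+2 X₁≤q (proj₂ room₁ 1≤r))
          where
          shift : ∀ S u b c e → suc (S + u + b + c + e) ≡ S + b + c + e + suc u
          shift = solve-∀

-- The minimum and maximum defining the peak

∈-allSubsets : ∀ {n} (S : Subset n) → S ∈ allSubsets n
∈-allSubsets []ᵥ                 = here refl
∈-allSubsets (true  ∷ᵥ S)        = ∈-++⁺ˡ (∈-map⁺ (true ∷ᵥ_) (∈-allSubsets S))
∈-allSubsets {suc n} (false ∷ᵥ S) = ∈-++⁺ʳ (map (true ∷ᵥ_) (allSubsets n)) (∈-map⁺ (false ∷ᵥ_) (∈-allSubsets S))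

module _ {A : Set} (f : A → ℕ) where

  foldr-⊓-≤ : ∀ n {x} xs → x ∈ xs → foldr (λ y m → f y ⊓ m) n xs ≤ f x
  foldr-⊓-≤ n (x ∷ xs) (here refl) = m⊓n≤m (f x) _
  foldr-⊓-≤ n (y ∷ xs) (there x∈)  = ≤-trans (m⊓n≤n (f y) _) (foldr-⊓-≤ n xs x∈)

  foldr-⊓-≥ : ∀ k n xs → k ≤ n → (∀ x → x ∈ xs → k ≤ f x) → k ≤ foldr (λ y m → f y ⊓ m) n xs
  foldr-⊓-≥ k n []       k≤n h = k≤n
  foldr-⊓-≥ k n (x ∷ xs) k≤n h = ⊓-glb (h x (here refl)) (foldr-⊓-≥ k n xs k≤n (λ y → h y ∘ there))

  foldr-⊔-≥ : ∀ n {x} xs → x ∈ xs → f x ≤ foldr (λ y m → f y ⊔ m) n xs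
  foldr-⊔-≥ n (x ∷ xs) (here refl) = m≤m⊔n (f x) _
  foldr-⊔-≥ n (y ∷ xs) (there x∈)  = ≤-trans (foldr-⊔-≥ n xs x∈) (m≤n⊔m (f y) _)

  foldr-⊔-≤ : ∀ k n xs → n ≤ k → (∀ x → x ∈ xs → f x ≤ k) → foldr (λ y m → f y ⊔ m) n xs ≤ k
  foldr-⊔-≤ k n []       n≤k h = n≤k
  foldr-⊔-≤ k n (x ∷ xs) n≤k h = ⊔-lub (h x (here refl)) (foldr-⊔-≤ k n xs n≤k (λ y → h y ∘ there))

ΦV-≤ : ∀ q d k → (∀ s → s ≤ treeSize q d → ∃ λ (S : Subset (treeSize q d)) → ∣ S ∣ ≡ s × ∣ border q d S ∣ ≤ k) → ΦV q d ≤ k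
ΦV-≤ q d k h = foldr-⊔-≤ (ΦV-s q d) k 0 (upTo (suc (treeSize q d))) z≤n bound
  where
  bound : ∀ s → s ∈ upTo (suc (treeSize q d)) → ΦV-s q d s ≤ k
  bound s s∈ with h s (≤-pred (∈-upTo⁻ s∈))
  ... | S , ∣S∣≡s , δ≤k = ≤-trans
    (foldr-⊓-≤ (∣_∣ ∘ border q d) (treeSize q d) _ (∈-filter⁺ (λ S → ∣ S ∣ ≟ s) (∈-allSubsets S) ∣S∣≡s)) δ≤k

-- The bound `k ≤ treeSize q d` accounts for the initial value of the minimum fold.
ΦV-≥ : ∀ q d k s → s ≤ treeSize q d → k ≤ treeSize q d →
       (∀ (S : Subset (treeSize q d)) → ∣ S ∣ ≡ s → k ≤ ∣ border q d S ∣) → k ≤ ΦV q d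
ΦV-≥ q d k s s≤ k≤ h = ≤-trans
  (foldr-⊓-≥ (∣_∣ ∘ border q d) k (treeSize q d) _ k≤
    (λ S S∈ → h S (proj₂ (∈-filter⁻ (λ S → ∣ S ∣ ≟ s) {xs = allSubsets (treeSize q d)} S∈))))
  (foldr-⊔-≥ (ΦV-s q d) 0 (upTo (suc (treeSize q d))) (∈-upTo⁺ (s≤s s≤)))

-- Choice of parameters and the two bounds

floor-log : ∀ q x → 2 ≤ q → 1 ≤ x → ∃ λ n → q ^ n ≤ x × x < q ^ suc n
floor-log q x 2≤q 1≤x = descend x (x<q^x x)
  where
  x<q^x : ∀ x → x < q ^ x
  x<q^x zero    = s≤s z≤n
  x<q^x (suc x) = ≤-trans (s≤s (x<q^x x)) (≤-trans (double (q ^ x) (≤-trans (s≤s z≤n) (x<q^x x))) (*-monoˡ-≤ (q ^ x) 2≤q))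
    where
    double : ∀ y → 1 ≤ y → suc y ≤ 2 * y
    double y 1≤y = farkas 1≤y 0 (solve (y ∷ []))
  descend : ∀ m → x < q ^ m → ∃ λ n → q ^ n ≤ x × x < q ^ suc n
  descend zero    x<1 = ⊥-elim (n≮n 1 (≤-trans (s≤s 1≤x) x<1))
  descend (suc m) x<  with q ^ m ≤? x
  ... | yes q^m≤x = m , q^m≤x , x<
  ... | no  q^m≰x = descend m (≰⇒> q^m≰x)

-- Guarantees that the size T_0 + ... + T_d used for the lower bound fits into the tree.
ΣT≤T : ∀ q n → 2 ≤ q → Σ< (T q) n ≤ T q n
ΣT≤T q zero    _   = z≤n
ΣT≤T q (suc n) 2≤q = go (Σ< (T q) n) (T q n) (ΣT≤T q n 2≤q) (*-monoˡ-≤ (T q n) 2≤q)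
  where
  go : ∀ Z t → Z ≤ t → 2 * t ≤ q * t → Z + t ≤ suc (q * t)
  go Z t Z≤t h = ≤-trans (+-monoˡ-≤ t Z≤t) (≤-trans (≤-reflexive (cong (t +_) (sym (+-identityʳ t)))) (≤-trans h (n≤1+n _)))

-- Choose n with q^n ≤ 2 d q^3 < q^{n+1}. The right inequality gives T_n ≥ 2 d q, large enough for
-- `isoperimetric`. The left one turns d + 2 ≤ Φ + n into the claim.
ΦV-lower : ∀ q d → 3 ≤ q → 1 ≤ d → q ^ d ≤ 2 * d * q ^ suc (ΦV q d)
ΦV-lower q d 3≤q 1≤d with floor-log q (2 * d * q ^ 3) (≤-trans (n≤1+n 2) 3≤q)
                         (*-mono-≤ (*-mono-≤ (s≤s {n = 1} z≤n) 1≤d) (m^n>0 q {{>-nonZero (≤-trans (s≤s z≤n) 3≤q)}} 3))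
... | n , q^n≤ , <q^1+n = *-cancelʳ-≤ _ _ (q ^ 2) {{>-nonZero (m^n>0 q {{q≢0}} 2)}} (begin
  q ^ d * q ^ 2                        ≡⟨ ^-distribˡ-+-* q d 2 ⟨
  q ^ (d + 2)                          ≤⟨ ^-monoʳ-≤ q {{q≢0}} d+2≤Φ+n ⟩
  q ^ (Φ + n)                          ≡⟨ ^-distribˡ-+-* q Φ n ⟩
  q ^ Φ * q ^ n                        ≤⟨ *-monoʳ-≤ (q ^ Φ) q^n≤ ⟩
  q ^ Φ * (2 * d * q ^ 3)              ≡⟨ regroup q d (q ^ Φ) ⟩
  2 * d * q ^ suc Φ * q ^ 2            ∎)
  where
  open ≤-Reasoning
  q≢0 : NonZero q
  q≢0 = >-nonZero (≤-trans (s≤s z≤n) 3≤q)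
  0<q : 1 ≤ q
  0<q = ≤-trans (s≤s z≤n) 3≤q
  Φ = ΦV q d
  regroup : ∀ q d y → y * (2 * d * (q * (q * (q * 1)))) ≡ 2 * d * (q * y) * (q * (q * 1))
  regroup = solve-∀
  t = T q n
  2dq≤t : 2 * d * q ≤ t
  2dq≤t = *-cancelˡ-≤ q {{q≢0}} (go q d t (q ^ n) (T-power q n)
    (*-cancelˡ-< q _ _ (≤-trans (≤-reflexive (cong suc (before q d))) <q^1+n)))
    where
    before : ∀ q d → q * (2 * d * q * q) ≡ 2 * d * (q * (q * (q * 1)))
    before = solve-∀
    go : ∀ q d t y → q * t + 1 ≡ t + y → 2 * d * q * q < y → q * (2 * d * q) ≤ q * t
    go q d t y e h = farkas (+-mono-≤ (≤-reflexive (sym e)) h) t (solve (q ∷ d ∷ t ∷ y ∷ []))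
  1≤n : 1 ≤ n
  1≤n = n≢0 n 2dq≤t
    where
    n≢0 : ∀ n → 2 * d * q ≤ T q n → 1 ≤ n
    n≢0 zero    h = ⊥-elim (n≮n 0 (≤-trans (*-mono-≤ (*-mono-≤ (s≤s {n = 1} z≤n) 1≤d) 0<q) h))
    n≢0 (suc n) _ = s≤s z≤n
  border-large : ∀ S → ∣ S ∣ ≡ Σ< (T q) (suc d) → suc d < ∣ border q d S ∣ + n
  border-large S ∣S∣≡ with suc d <? ∣ border q d S ∣ + n
  ... | yes large = large
  -- If the border were too small, it would have at most d vertices, and both smallness hypotheses
  -- would hold.
  ... | no  small = isoperimetric q d n S 3≤q ∣S∣≡
        (≤-trans (scale q k≤d) (≤-trans (≤-reflexive (*-comm q d)) (≤-trans (*-monoˡ-≤ q (m≤m+n d _)) (≤-trans 2dq≤t (m≤m+n t d)))))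
        (≤-trans (go d _ k≤d 1≤d) (≤-trans (*-monoʳ-≤ (2 * d) 3≤q) 2dq≤t))
    where
    k≤d : ∣ border q d S ∣ ≤ d
    k≤d = ≤-pred (≤-trans (≤-reflexive (+-comm 1 _)) (≤-trans (+-monoʳ-≤ ∣ border q d S ∣ 1≤n) (≮⇒≥ small)))
    go : ∀ d k → k ≤ d → 1 ≤ d → suc (k + suc d) ≤ 2 * d * 3
    go d k k≤d 1≤d = farkas (+-mono-≤ k≤d (scale 2 1≤d)) (2 * d) (solve (k ∷ d ∷ []))
  d+2≤Φ+n : d + 2 ≤ Φ + n
  d+2≤Φ+n = ≤-trans (m≤n+m∸n (d + 2) n) (≤-trans (≤-reflexive (+-comm n _)) (+-monoˡ-≤ n
    (ΦV-≥ q d (d + 2 ∸ n) (Σ< (T q) (suc d))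
      (≤-trans (ΣT≤T q (suc d) (≤-trans (n≤1+n 2) 3≤q)) (≤-reflexive (sym (treeSize≡T q d))))
      (m≤n+o⇒m∸n≤o (d + 2) n (≤-trans (≤-reflexive (+-comm d 2))
        (+-mono-≤ 1≤n (≤-trans (n≤T q (suc d) 0<q) (≤-reflexive (sym (treeSize≡T q d)))))))
      (λ S ∣S∣≡ → m≤n+o⇒m∸n≤o (d + 2) n (≤-trans (≤-reflexive (+-comm d 2))
        (≤-trans (border-large S ∣S∣≡) (≤-reflexive (+-comm _ n))))))))

module _ (q : ℕ) (3≤q : 3 ≤ q) (q≤4 : q ≤ 4) where

  private
    0<q : 1 ≤ q
    0<q = ≤-trans (s≤s z≤n) 3≤q

  open Construction q 0<q
  open Realise q 0<q

  empty : ∀ l → Reach l 0 0 0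
  empty zero    = root z≤n
  empty (suc l) = subst (λ a → Reach (suc l) a a 0) (*-zeroʳ q) (zero-step (empty l) z≤n)

  -- If s ≤ q T_{d-L}, the greedy expansion may start on level L, below empty levels. If s > q T_d,
  -- the set is the whole tree. Otherwise greedy digits are followed by i = q T_L blocks, and 1 + i
  -- = T_{L+1} is exactly what `blocks` requires.
  small-border : ∀ d L s → q * T q L * 3 + 1 + (L + L) ≤ d → s ≤ T q (suc d) → ∃ λ k → Done d s k × k + L ≤ d
  small-border d L s L≤ s≤ with s ≤? q * T q (d ∸ L)
  ... | yes s≤′ = d ∸ L ,
        greedy d (d ∸ L) L 0 0 0 s (m+[n∸m]≡n L≤d) (empty L) (z≤n , λ _ → m^n>0 q {{>-nonZero 0<q}} L) s≤′ ,
        ≤-reflexive (m∸n+n≡m L≤d)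
    where
    L≤d : L ≤ d
    L≤d = m+n≤o⇒m≤o L (m+n≤o⇒n≤o (q * T q L * 3 + 1) L≤)
  ... | no  s≰′ with s ≤? q * T q d
  ...   | no  s≰qT = 0 , subst (λ s → Done d s 0) full (zeros d d 0 1 1 0 refl (root ≤-refl) ≤-refl) ,
          m+n≤o⇒m≤o L (m+n≤o⇒n≤o (q * T q L * 3 + 1) L≤)
    where
    full : 1 + 1 * (q * T q d) ≡ s
    full = trans (cong suc (+-identityʳ _)) (≤-antisym (≰⇒> s≰qT) s≤)
  ...   | yes s≤qT = n + (i * 3 + 1) , from-prefix (greedy-prefix n j n 0 0 0 0 s refl (root z≤n) (z≤n , λ _ → s≤s z≤n)
                       (≤-trans s≤qT (≤-reflexive (cong (λ m → q * T q m) (sym n+j≡d)))) (λ _ → refl)) ,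
          ≤-reflexive (trans (regroup n i L) n+j≡d)
    where
    i j n : ℕ
    i = q * T q L
    j = i * 3 + suc L
    n = d ∸ j
    regroup : ∀ n i L → n + (i * 3 + 1) + L ≡ n + (i * 3 + suc L)
    regroup = solve-∀
    L+j≤d : L + j ≤ d
    L+j≤d = ≤-trans (≤-reflexive (shift L i)) L≤
      where
      shift : ∀ L i → L + (i * 3 + suc L) ≡ i * 3 + 1 + (L + L)
      shift = solve-∀
    n+j≡d : n + j ≡ d
    n+j≡d = m∸n+n≡m (≤-trans (m≤n+m j L) L+j≤d)
    from-prefix : Prefix n j n s → Done d s (n + (i * 3 + 1))
    from-prefix (prefix a S r reach room r≤ total a≡0⇒S≡0) = subst (λ s → Done d s (n + (i * 3 + 1))) total
      (blocks q≤4 d L i n a S n r 0 0 n+j≡d (1≤a a total a≡0⇒S≡0) room r≤ ≤-refl (up , down))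
      where
      1≤a : ∀ a → S + a * (q * T q j) + r ≡ s → (a ≡ 0 → S ≡ 0) → 1 ≤ a
      1≤a (suc a) _ _ = s≤s z≤n
      1≤a zero    e h = ⊥-elim (s≰′ (≤-trans (≤-reflexive (sym (trans (sym (cong (λ S → S + 0 + r) (h refl))) e)))
                          (≤-trans r≤ (scale q (T-mono q (m+n≤o⇒m≤o∸n j (≤-trans (≤-reflexive (+-comm j L)) L+j≤d)))))))
      up : ∀ u → u ≤ 0 → Reach n a (S + u) n
      up zero _ = subst (λ S → Reach n a S n) (sym (+-identityʳ S)) reach
      down : ∀ u → u ≤ 0 → ∃ λ S′ → S′ + u ≡ S × Reach n a S′ n
      down zero _ = S , +-identityʳ S , reach

  ΦV-upper : ∀ d → 1 ≤ d → d * q ^ ΦV q d ≤ q ^ (d + 3)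
  ΦV-upper d 1≤d with floor-log q d (≤-trans (n≤1+n 2) 3≤q) 1≤d
  ... | e , q^e≤d , d<q^1+e = begin
    d * q ^ Φ                  ≤⟨ *-monoˡ-≤ (q ^ Φ) (<⇒≤ d<q^1+e) ⟩
    q ^ suc e * q ^ Φ          ≡⟨ ^-distribˡ-+-* q (suc e) Φ ⟨
    q ^ (suc e + Φ)            ≤⟨ ^-monoʳ-≤ q {{>-nonZero 0<q}} exponent ⟩
    q ^ (d + 3)                ∎
    where
    open ≤-Reasoning
    Φ L : ℕ
    Φ = ΦV q d
    -- Two less than the integer logarithm, so that 3 q T_L + 1 + 2 L ≤ q^{L+2} ≤ d when e ≥ 2.
    -- These two and the rounding of the logarithm make up the 3 in the exponent.
    L = e ∸ 2
    room : ∀ e → q ^ e ≤ d → q * T q (e ∸ 2) * 3 + 1 + (e ∸ 2 + (e ∸ 2)) ≤ d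
    room zero          _ rewrite *-zeroʳ q = 1≤d
    room (suc zero)    _ rewrite *-zeroʳ q = 1≤d
    room (suc (suc L)) h = ≤-trans (go q (T q L) L (q ^ L) (T-power q L) (n≤T q L 0<q) 3≤q) h
      where
      go : ∀ q t L y → q * t + 1 ≡ t + y → L ≤ t → 3 ≤ q → q * t * 3 + 1 + (L + L) ≤ q * (q * y)
      -- With q = p + 3 and y = (p + 2) t + 1, the difference of the two sides is 2 (t - L) plus a
      -- polynomial with nonnegative coefficients.
      go (suc (suc (suc p))) t L y e L≤t (s≤s (s≤s (s≤s _))) rewrite +-cancelˡ-≡ t y ((2 + p) * t + 1) (trans (sym e) (+-assoc t _ 1)) =
        farkas (+-mono-≤ L≤t L≤t) ((7 + 18 * p + 8 * (p * p) + p * (p * p)) * t + 8 + 6 * p + p * p) (solve (p ∷ t ∷ L ∷ []))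
    Φ≤ : Φ ≤ d ∸ L
    Φ≤ = ΦV-≤ q d (d ∸ L) witness
      where
      witness : ∀ s → s ≤ treeSize q d → ∃ λ (S : Subset (treeSize q d)) → ∣ S ∣ ≡ s × ∣ border q d S ∣ ≤ d ∸ L
      witness s s≤ with small-border d L s (room e q^e≤d) (≤-trans s≤ (≤-reflexive (treeSize≡T q d)))
      ... | k , (a , p) , k+L≤d with realise p
      ...   | S , ∣S∣≡s , δ≤ = S , ∣S∣≡s , ≤-trans δ≤ (≤-trans (≤-reflexive (+-identityʳ k)) (m+n≤o⇒m≤o∸n k k+L≤d))
    exponent : suc e + Φ ≤ d + 3
    exponent = begin
      suc e + Φ                ≤⟨ +-mono-≤ (s≤s (m≤n+m∸n e 2)) Φ≤ ⟩
      3 + L + (d ∸ L)          ≡⟨ cong (3 +_) (m+[n∸m]≡n L≤d) ⟩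
      3 + d                    ≡⟨ +-comm 3 d ⟩
      d + 3                    ∎
      where
      L≤d : L ≤ d
      L≤d = m+n≤o⇒m≤o L (m+n≤o⇒n≤o (q * T q L * 3 + 1) (room e q^e≤d))

-- Raising q to both sides removes the logarithms: the first inequality is ε ≥ -1 - log_q 2, the
-- second is ε ≤ 3.
theorem1p5 : (q d : ℕ) → (q ≡ 3 ⊎ q ≡ 4) → 1 ≤ d →
    (q ^ d ≤ 2 * d * q ^ suc (ΦV q d)) × (d * q ^ ΦV q d ≤ q ^ (d + 3))
theorem1p5 q d (inj₁ refl) 1≤d = ΦV-lower q d ≤-refl 1≤d , ΦV-upper q ≤-refl (n≤1+n 3) d 1≤d
theorem1p5 q d (inj₂ refl) 1≤d = ΦV-lower q d (n≤1+n 3) 1≤d , ΦV-upper q (n≤1+n 3) ≤-refl d 1≤d
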